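{- For every connected graph $G$ on at least two vertices, $$\operatorname{cdim}(G)\geq \frac{\operatorname{b}(G)+1}{2},$$ where $\operatorname{b}(G)$ is the number of blocks of $G$.
   Context: All graphs are nonempty, finite, simple and undirected. For distinct vertices $v,w$ of a graph $G$, $\kappa(v,w)$ denotes the maximum number of internally vertex-disjoint $v$–$w$ paths in $G$; by convention $\kappa(v,v)=\infty$. For an ordered vertex set $W=\{w_1,\ldots,w_k\}\subseteq V(G)$, the connectivity representation of $v$ is $r(v,W)=[\kappa(v,w_1),\ldots,\kappa(v,w_k)]$. $W$ is resolving for $G$ if $r(v_1,W)=r(v_2,W)$ implies $v_1=v_2$ for all $v_1,v_2\in V(G)$. The connectivity dimension $\operatorname{cdim}(G)$ is the minimum cardinality of a resolving set of $G$. A block of $G$ is a maximal connected subgraph of $G$ that has no cut vertex of its own. -}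

module Defs where

open import Data.Nat using (ℕ; suc; _≤_)
open import Data.Fin using (Fin)
open import Data.Bool using (Bool; false; T)
open import Data.List using (List; []; _∷_)
open import Data.List.Membership.Propositional using (_∈_; _∉_)
open import Data.List.Relation.Unary.Unique.Propositional using (Unique)
open import Data.Product using (Σ; _×_; _,_)
open import Data.Sum using (_⊎_)
open import Relation.Nullary using (¬_)
open import Relation.Binary.PropositionalEquality using (_≡_; _≢_)
open import Function.Definitions using (Injective)

record Graph (n : ℕ) : Set where
  field
    adj    : Fin n → Fin n → Bool
    sym    : ∀ u v → adj u v ≡ adj v u
    irrefl : ∀ v → adj v v ≡ false
open Graph public

data WalkL {n : ℕ} (E : Fin n → Fin n → Bool) : Fin n → Fin n → List (Fin n) → Set where
  here : ∀ v → WalkL E v v (v ∷ [])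
  step : ∀ {u v w vs} → T (E u v) → WalkL E v w vs → WalkL E u w (u ∷ vs)

IsPath : ∀ {n} → Graph n → Fin n → Fin n → List (Fin n) → Set
IsPath G v w p = WalkL (adj G) v w p × Unique p

record DisjPaths {n : ℕ} (G : Graph n) (v w : Fin n) (k : ℕ) : Set where
  field
    paths    : Fin k → List (Fin n)
    isPath   : ∀ i → IsPath G v w (paths i)
    distinct : ∀ i j → i ≢ j → paths i ≢ paths j
    disjoint : ∀ i j → i ≢ j → ∀ x → x ∈ paths i → x ∈ paths j → (x ≡ v) ⊎ (x ≡ w)

data ℕ∞ : Set where
  fin : ℕ → ℕ∞
  ∞   : ℕ∞

-- Kappa G v w x : κ(v,w) = x  (κ(v,v) = ∞; otherwise the maximum k
-- such that there are k internally vertex-disjoint v–w paths).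
Kappa : ∀ {n} → Graph n → Fin n → Fin n → ℕ∞ → Set
Kappa G v w ∞       = v ≡ w
Kappa G v w (fin k) = (v ≢ w) × DisjPaths G v w k × ¬ DisjPaths G v w (suc k)

SameRep : ∀ {n k} → Graph n → (Fin k → Fin n) → Fin n → Fin n → Set
SameRep G W v₁ v₂ = ∀ i x → (Kappa G v₁ (W i) x → Kappa G v₂ (W i) x)
                          × (Kappa G v₂ (W i) x → Kappa G v₁ (W i) x)

Resolving : ∀ {n k} → Graph n → (Fin k → Fin n) → Set
Resolving G W = ∀ v₁ v₂ → SameRep G W v₁ v₂ → v₁ ≡ v₂

IsCdim : ∀ {n} → Graph n → ℕ → Set
IsCdim {n} G d =
  (Σ (Fin d → Fin n) λ W → Injective _≡_ _≡_ W × Resolving G W)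
  × (∀ k (W : Fin k → Fin n) → Injective _≡_ _≡_ W → Resolving G W → d ≤ k)

Connected : ∀ {n} → Graph n → Set
Connected {n} G = ∀ u v → Σ (List (Fin n)) λ p → WalkL (adj G) u v p

record Subgraph {n : ℕ} (G : Graph n) : Set where
  field
    vs     : Fin n → Bool
    es     : Fin n → Fin n → Bool
    es-sym : ∀ u v → es u v ≡ es v u
    es-sub : ∀ u v → T (es u v) → T (adj G u v) × T (vs u) × T (vs v)
open Subgraph public

module _ {n : ℕ} {G : Graph n} where

  SubConnected : Subgraph G → Set
  SubConnected H = Σ (Fin n) (λ v → T (vs H v))
    × (∀ u v → T (vs H u) → T (vs H v) → Σ (List (Fin n)) λ p → WalkL (es H) u v p)

  HasCutVertex : Subgraph G → Set
  HasCutVertex H = Σ (Fin n) λ x → T (vs H x) × Σ (Fin n) λ u → Σ (Fin n) λ w →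
    T (vs H u) × T (vs H w) × u ≢ x × w ≢ x ×
    ¬ (Σ (List (Fin n)) λ p → WalkL (es H) u w p × x ∉ p)

  Nonseparable : Subgraph G → Set
  Nonseparable H = SubConnected H × ¬ HasCutVertex H

  _⊆ₛ_ : Subgraph G → Subgraph G → Set
  H ⊆ₛ H' = (∀ v → T (vs H v) → T (vs H' v)) × (∀ u v → T (es H u v) → T (es H' u v))

  _≈ₛ_ : Subgraph G → Subgraph G → Set
  H ≈ₛ H' = (∀ v → vs H v ≡ vs H' v) × (∀ u v → es H u v ≡ es H' u v)

  IsBlock : Subgraph G → Set
  IsBlock H = Nonseparable H × (∀ H' → Nonseparable H' → H ⊆ₛ H' → H ≈ₛ H')

NumBlocks : ∀ {n} → Graph n → ℕ → Set
NumBlocks G m = Σ (Fin m → Subgraph G) λ B →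
  (∀ i → IsBlock (B i))
  × (∀ i j → B i ≈ₛ B j → i ≡ j)
  × (∀ H → IsBlock H → Σ (Fin m) λ i → H ≈ₛ B i)

{-# OPTIONS --safe #-}
module Submission where

-- Call two vertices inseparable (∼) if no third vertex separates them. The blocks are exactly the
-- maximal cliques of ∼, two blocks share at most one vertex, and κ(v,w) is 1 unless v and w lie in a
-- common block with m ≥ 3 vertices, in which case 2 ≤ κ(v,w) ≤ m - 1 (the lower bound is Whitney's
-- theorem). Rooting the graph shows that the sum of the |B| is at most n + b - 1.
--
-- Let W be resolving with d elements, and call a block visible if it has at least 3 vertices and meets
-- W. A vertex outside W lying in no visible block has representation [1,…,1], so there is at most one.
-- Every other vertex outside W takes 2 from its visible block if there is only one (it is then private
-- to that block) and 1 from each of them otherwise. A visible block B must keep 4 of its 2|B|; it can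
-- fail to do so only when W ∩ B = {w}. In that case κ(·,w) is injective on the private vertices of B
-- with values in [2, |B| - 1], so the deficit is at most 1, and it occurs only when some private v
-- has κ(v,w) = 2; each w is responsible for at most one such block. Summing up,
-- 4b + 2(n - d) ≤ 2(n + b - 1) + d + 2, that is 2b ≤ 3d, which is stronger than b + 1 ≤ 2d.

open import Defs
open import Data.Bool using (Bool; true; false; T; _∧_; not; if_then_else_; T?)
open import Data.Bool.Properties using (T-∧; ∧-comm)
open import Data.Nat using (ℕ; zero; suc; _≤_; _<_; _+_; _*_; _∸_; z≤n; s≤s; s≤s⁻¹; _≟_; _≤?_)
open import Data.Nat.Properties
open import Data.Nat.Solver using (module +-*-Solver)
open import Data.Fin using (Fin; zero; suc; fromℕ<; inject≤)
import Data.Fin.Properties as Fin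
open import Data.List using (List; []; _∷_)
open import Data.List.Membership.Propositional using (_∈_; _∉_)
import Data.List.Membership.DecPropositional as DecMembership
open import Data.List.Relation.Unary.Any using (here; there)
open import Data.List.Relation.Unary.All as All using ([]; _∷_)
open import Data.List.Relation.Unary.AllPairs using ([]; _∷_)
open import Data.List.Relation.Unary.Unique.Propositional using (Unique)
open import Data.List.Relation.Binary.Subset.Propositional using (_⊆_)
open import Data.Product using (∃; ∃₂; _×_; _,_; proj₁; proj₂)
open import Data.Sum as Sum using (_⊎_; inj₁; inj₂; [_,_]′)
open import Data.Unit using (tt)
open import Effect.Monad using (RawMonad)
open import Function using (_∘_; id; case_of_; Equivalence)
open import Function.Definitions using (Injective)
open import Relation.Nullary using (¬_; Dec; yes; no; _because_; contradiction)
open import Relation.Nullary.Decidable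
  using (_×-dec_; _⊎-dec_; _→-dec_; ¬?; ⌊_⌋; toWitness; fromWitness; ¬¬-excluded-middle; decidable-stable)
open import Relation.Nullary.Negation using (¬¬-Monad; ¬¬-map)
open import Relation.Unary using (Decidable)
open import Relation.Binary.PropositionalEquality as ≡ using (_≡_; _≢_; refl; cong; cong₂; subst)
open import Algebra.Properties.CommutativeMonoid.Sum +-0-commutativeMonoid
  using (sum; ∑-distrib-+; ∑-comm; sum-cong-≗)

-- Counting in finite sets

sum-mono : ∀ {n} {f g : Fin n → ℕ} → (∀ i → f i ≤ g i) → sum f ≤ sum g
sum-mono {zero}  f≤g = z≤n
sum-mono {suc n} f≤g = +-mono-≤ (f≤g zero) (sum-mono (λ i → f≤g (suc i)))

sum-const : ∀ n c → sum {n} (λ _ → c) ≡ n * c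
sum-const zero    c = refl
sum-const (suc n) c = cong (c +_) (sum-const n c)

sum-*ʳ : ∀ {n} (f : Fin n → ℕ) c → sum (λ i → f i * c) ≡ sum f * c
sum-*ʳ {zero}  f c = refl
sum-*ʳ {suc n} f c = ≡.trans (cong (f zero * c +_) (sum-*ʳ (λ i → f (suc i)) c))
                             (≡.sym (*-distribʳ-+ c (f zero) _))

term≤sum : ∀ {n} (f : Fin n → ℕ) i → f i ≤ sum f
term≤sum f zero    = m≤m+n _ _
term≤sum f (suc i) = ≤-trans (term≤sum (λ j → f (suc j)) i) (m≤n+m _ _)

private variable
  A B C D : Set
  n k : ℕ
  P : Fin n → Set
  Q : Fin k → Set

ind : Dec A → ℕ
ind (true  because _) = 1
ind (false because _) = 0

ind-yes : (a? : Dec A) → A → ind a? ≡ 1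
ind-yes (yes _) a = refl
ind-yes (no ¬a) a = contradiction a ¬a

ind-no : (a? : Dec A) → ¬ A → ind a? ≡ 0
ind-no (yes a) ¬a = contradiction a ¬a
ind-no (no _)  ¬a = refl

ind≤1 : (a? : Dec A) → ind a? ≤ 1
ind≤1 (yes _) = ≤-refl
ind≤1 (no _)  = z≤n

ind-mono : (a? : Dec A) (b? : Dec B) → (A → B) → ind a? ≤ ind b?
ind-mono (no _)  b? f = z≤n
ind-mono (yes a) b? f = ≤-reflexive (≡.sym (ind-yes b? (f a)))

# : Decidable P → ℕ
# P? = sum (λ i → ind (P? i))

#-pos : (P? : Decidable P) → ∀ {i} → P i → 1 ≤ # P?
#-pos P? {i} p = ≤-trans (≤-reflexive (≡.sym (ind-yes (P? i) p))) (term≤sum _ i)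

#-remove : (Q? : Decidable Q) → ∀ {j} → Q j → suc (# (λ x → Q? x ×-dec ¬? (x Fin.≟ j))) ≤ # Q?
#-remove {Q = Q} Q? {j} q = begin
  1 + # rest?          ≤⟨ +-monoˡ-≤ _ (#-pos (Fin._≟ j) refl) ⟩
  # (Fin._≟ j) + # rest?   ≡⟨ ∑-distrib-+ (λ x → ind (x Fin.≟ j)) (λ x → ind (rest? x)) ⟨
  sum (λ x → ind (x Fin.≟ j) + ind (rest? x)) ≤⟨ sum-mono split ⟩
  # Q? ∎
  where
  open ≤-Reasoning
  rest? = λ x → Q? x ×-dec ¬? (x Fin.≟ j)
  split : ∀ x → ind (x Fin.≟ j) + ind (rest? x) ≤ ind (Q? x)
  split x with x Fin.≟ j | Q? x
  ... | yes refl | yes _ = ≤-refl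
  ... | yes refl | no ¬q = contradiction q ¬q
  ... | no _     | yes _ = ≤-refl
  ... | no _     | no _  = ≤-refl

#-injection : ∀ {n} {P : Fin n → Set} (P? : Decidable P) (Q? : Decidable Q) (f : ∀ i → P i → Fin k) →
  (∀ i p → Q (f i p)) → (∀ i j p q → f i p ≡ f j q → i ≡ j) → # P? ≤ # Q?
#-injection {n = zero}  P? Q? f fQ inj = z≤n
#-injection {n = suc n} P? Q? f fQ inj with P? zero
... | no _  = #-injection (λ i → P? (suc i)) Q? (λ i → f (suc i)) (λ i → fQ (suc i))
                (λ i j p q e → Fin.suc-injective (inj _ _ p q e))
... | yes p = ≤-trans (s≤s (#-injection (λ i → P? (suc i))
                  (λ x → Q? x ×-dec ¬? (x Fin.≟ f zero p)) (λ i → f (suc i))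
                  (λ i q → fQ (suc i) q , λ e → Fin.0≢1+n (inj _ _ p q (≡.sym e)))
                  (λ i j p q e → Fin.suc-injective (inj _ _ p q e))))
                (#-remove Q? (fQ zero p))

#-all : ∀ n → # {n} (λ _ → yes tt) ≡ n
#-all n = ≡.trans (sum-const n 1) (*-identityʳ n)

#-bound : (P? : Decidable P) (f : ∀ i → P i → Fin k) →
  (∀ i j p q → f i p ≡ f j q → i ≡ j) → # P? ≤ k
#-bound {k = k} P? f inj =
  ≤-trans (#-injection P? (λ _ → yes tt) f _ inj) (≤-reflexive (#-all k))

#≤1 : (P? : Decidable P) → (∀ i j → P i → P j → i ≡ j) → # P? ≤ 1
#≤1 P? uniq = #-bound P? (λ _ _ → zero) (λ i j p q _ → uniq i j p q)

#≥2 : (P? : Decidable P) → ∀ {i j} → P i → P j → i ≢ j → 2 ≤ # P?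
#≥2 P? p q i≢j = ≤-trans (s≤s (#-pos (λ x → P? x ×-dec ¬? (x Fin.≟ _)) (q , λ e → i≢j (≡.sym e))))
                         (#-remove P? p)

#≡1⇒unique : (P? : Decidable P) → # P? ≡ 1 → ∀ {i j} → P i → P j → i ≡ j
#≡1⇒unique P? e {i} {j} p q with i Fin.≟ j
... | yes i≡j = i≡j
... | no i≢j  = contradiction (subst (2 ≤_) e (#≥2 P? p q i≢j)) λ { (s≤s ()) }

#-range : (P? : Decidable P) (f : Fin n → ℕ) (a : ℕ) →
  (∀ i → P i → a ≤ f i × f i < a + k) →
  (∀ i j → P i → P j → f i ≡ f j → i ≡ j) → # P? ≤ k
#-range {k = k} P? f a range inj = #-bound P? (λ i p → fromℕ< (lt i p)) λ i j p q e →
    inj i j p q (∸-cancelʳ-≡ (proj₁ (range i p)) (proj₁ (range j q))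
      (Fin.fromℕ<-injective _ _ (lt i p) (lt j q) e))
  where
  lt : ∀ i p → f i ∸ a < k
  lt i p = subst (f i ∸ a <_) (m+n∸m≡n a k) (∸-monoˡ-< (proj₂ (range i p)) (proj₁ (range i p)))

-- Discharging

-- Used with membership in `W`, visibility of the block, membership in the block and `deg v ≡ 1`:
-- the summands then mark private vertices, shared vertices and landmarks.
ind-split : (w? : Dec A) (h? : Dec B) (m? : Dec C) (e? : Dec D) → B →
  let x? = ¬? w? ×-dec h? ×-dec m? in
  ind (x? ×-dec e?) + ind (x? ×-dec ¬? e?) + ind (w? ×-dec m?) ≡ ind m?
ind-split w?      (no ¬b) m?      e?      b = contradiction b ¬b
ind-split (yes _) (yes _) (yes _) e?      b = refl
ind-split (yes _) (yes _) (no _)  e?      b = refl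
ind-split (no _)  (yes _) (yes _) (yes _) b = refl
ind-split (no _)  (yes _) (yes _) (no _)  b = refl
ind-split (no _)  (yes _) (no _)  e?      b = refl

-- The same cases with weights: of the 2 per vertex of the block, a private vertex takes everything,
-- a shared one leaves 1 and a landmark leaves 2.
ind-pay-split : (w? : Dec A) (h? : Dec B) (m? : Dec C) (e? : Dec D) → B →
  let x? = ¬? w? ×-dec h? ×-dec m? in
  ind x? * (1 + ind e?) + ind (x? ×-dec ¬? e?) + ind (w? ×-dec m?) * 2 ≡ ind m? * 2
ind-pay-split w?      (no ¬b) m?      e?      b = contradiction b ¬b
ind-pay-split (yes _) (yes _) (yes _) e?      b = refl
ind-pay-split (yes _) (yes _) (no _)  e?      b = refl
ind-pay-split (no _)  (yes _) (yes _) (yes _) b = refl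
ind-pay-split (no _)  (yes _) (yes _) (no _)  b = refl
ind-pay-split (no _)  (yes _) (no _)  e?      b = refl

-- Graphs enter only through these parameters, an incidence relation and a numerical `κ`.
-- `resolving` compares only vertices outside `W`, where the value ∞ does not occur.
module Discharging {n b d : ℕ}
  (In : Fin b → Fin n → Set) (in? : ∀ i v → Dec (In i v))
  (W : Fin d → Fin n) (W-injective : Injective _≡_ _≡_ W)
  (κ : Fin n → Fin n → ℕ)
  (size≥2 : ∀ i → 2 ≤ # (in? i))
  (κ-apart : ∀ {v w} → v ≢ w → (∀ i → 3 ≤ # (in? i) → In i v → ¬ In i w) → κ v w ≡ 1)
  (κ-block : ∀ i {v w} → 3 ≤ # (in? i) → In i v → In i w → v ≢ w → 2 ≤ κ v w × κ v w < # (in? i))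
  (resolving : ∀ u v → ¬ (∃ λ j → W j ≡ u) → ¬ (∃ λ j → W j ≡ v) →
               (∀ j → κ u (W j) ≡ κ v (W j)) → u ≡ v)
  where

  size : Fin b → ℕ
  size i = # (in? i)

  InW : Fin n → Set
  InW v = ∃ λ j → W j ≡ v

  inW? : Decidable InW
  inW? v = Fin.any? (λ j → W j Fin.≟ v)

  Visible : Fin b → Set
  Visible i = 3 ≤ size i × ∃ λ j → In i (W j)

  visible? : Decidable Visible
  visible? i = (3 ≤? size i) ×-dec Fin.any? (λ j → in? i (W j))

  VisibleAt : Fin n → Fin b → Set
  VisibleAt v i = ¬ InW v × Visible i × In i v

  visibleAt? : ∀ v → Decidable (VisibleAt v)
  visibleAt? v i = ¬? (inW? v) ×-dec visible? i ×-dec in? i v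

  deg : Fin n → ℕ
  deg v = # (visibleAt? v)

  pay : Fin b → Fin n → ℕ
  pay i v = ind (visibleAt? v i) * (1 + ind (deg v ≟ 1))

  Hidden : Fin n → Set
  Hidden v = ¬ InW v × deg v ≡ 0

  hidden? : Decidable Hidden
  hidden? v = ¬? (inW? v) ×-dec (deg v ≟ 0)

  Only : Fin b → Fin d → Set
  Only i j = In i (W j) × (∀ j′ → In i (W j′) → j′ ≡ j)

  Private : Fin b → Fin n → Set
  Private i v = VisibleAt v i × deg v ≡ 1

  Shared : Fin b → Fin n → Set
  Shared i v = VisibleAt v i × deg v ≢ 1

  shared? : ∀ i → Decidable (Shared i)
  shared? i v = visibleAt? v i ×-dec ¬? (deg v ≟ 1)

  private? : ∀ i → Decidable (Private i)
  private? i v = visibleAt? v i ×-dec (deg v ≟ 1)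

  -- The value 2 is the least possible. Excluding it raises the guaranteed number of shared vertices
  -- from 1 to 2 (see `needed`).
  Deficient : Fin b → Set
  Deficient i = ∃ λ j → Only i j × ∃ λ v → Private i v × κ v (W j) ≡ 2

  deficient? : Decidable Deficient
  deficient? i = Fin.any? λ j →
    (in? i (W j) ×-dec Fin.all? (λ j′ → in? i (W j′) →-dec (j′ Fin.≟ j)))
    ×-dec Fin.any? (λ v → private? i v ×-dec (κ v (W j) ≟ 2))

  ≢W : ∀ {v} → ¬ InW v → ∀ j → v ≢ W j
  ≢W ¬w j refl = ¬w (j , refl)

  hidden≤1 : # hidden? ≤ 1
  hidden≤1 = #≤1 hidden? λ u v (¬u , hu) (¬v , hv) →
    resolving u v ¬u ¬v λ j → ≡.trans (κ≡1 ¬u hu j) (≡.sym (κ≡1 ¬v hv j))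
    where
    κ≡1 : ∀ {v} → ¬ InW v → deg v ≡ 0 → ∀ j → κ v (W j) ≡ 1
    κ≡1 {v} ¬w h j = κ-apart (≢W ¬w j) λ i big v∈ w∈ →
      contradiction (subst (1 ≤_) h (#-pos (visibleAt? v) (¬w , (big , j , w∈) , v∈))) λ ()

  -- A block with at least 3 vertices through `v` and `W j′` would be visible at `v`, hence equal to
  -- `i` by `deg v ≡ 1`; but `i` has no landmark besides `W j`.
  private-κ : ∀ {i j v} → Only i j → Private i v → ∀ j′ → j′ ≢ j → κ v (W j′) ≡ 1
  private-κ {v = v} (_ , only) (vis@(¬w , _) , deg≡1) j′ j′≢j =
    κ-apart (≢W ¬w j′) λ i′ big v∈ w∈ →
      j′≢j (only j′ (subst (λ x → In x (W j′))
        (#≡1⇒unique (visibleAt? v) deg≡1 (¬w , (big , j′ , w∈) , v∈) vis) w∈))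

  -- All other landmarks give the value 1 to both vertices, so the value at `W j` decides. Allowing
  -- two blocks serves `deficient≤d`.
  private-injective : ∀ {i i′ j u v} → Only i j → Only i′ j → Private i u → Private i′ v →
                      κ u (W j) ≡ κ v (W j) → u ≡ v
  private-injective {j = j} {u} {v} o o′ p p′ e =
    resolving u v (proj₁ (proj₁ p)) (proj₁ (proj₁ p′)) same
    where
    same : ∀ j′ → κ u (W j′) ≡ κ v (W j′)
    same j′ with j′ Fin.≟ j
    ... | yes refl = e
    ... | no j′≢j  = ≡.trans (private-κ o p j′ j′≢j) (≡.sym (private-κ o′ p′ j′ j′≢j))

  -- Each deficient block is charged to its landmark. Two blocks charged to the same one have
  -- private vertices with equal value 2, hence a common private vertex, which has only one visible
  -- block.
  deficient≤d : # deficient? ≤ d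
  deficient≤d = #-bound deficient? (λ i → proj₁) λ
    { i i′ (j , o , v , p , e) (.j , o′ , v′ , p′ , e′) refl → same-block o o′ p p′ (≡.trans e (≡.sym e′)) }
    where
    same-block : ∀ {i i′ j u v} → Only i j → Only i′ j → Private i u → Private i′ v →
                 κ u (W j) ≡ κ v (W j) → i ≡ i′
    same-block o o′ p p′ e with private-injective o o′ p p′ e
    ... | refl = #≡1⇒unique (visibleAt? _) (proj₂ p) (proj₁ p) (proj₁ p′)

  -- The payments to `v` sum to `deg v * (1 + ind (deg v ≟ 1))`, so only the degree matters: at 0
  -- the vertex is hidden, at 1 it gets 2, beyond that at least 1 from each of two blocks.
  vertex-paid : ∀ v → ind (¬? (inW? v)) * 2 ≤ sum (λ i → pay i v) + ind (hidden? v) * 2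
  vertex-paid v = subst (λ x → ind (¬? (inW? v)) * 2 ≤ x + ind (hidden? v) * 2)
    (≡.sym (sum-*ʳ (λ i → ind (visibleAt? v i)) (1 + ind (deg v ≟ 1)))) (by-degree (inW? v) (deg v))
    where
    by-degree : ∀ (w? : Dec (InW v)) x →
      ind (¬? w?) * 2 ≤ x * (1 + ind (x ≟ 1)) + ind (¬? w? ×-dec (x ≟ 0)) * 2
    by-degree (yes _) x = z≤n
    by-degree (no _) zero = ≤-refl
    by-degree (no _) (suc zero) = ≤-refl
    by-degree (no _) (suc (suc x)) = s≤s (s≤s z≤n)

  landmark? : ∀ i → Decidable (λ v → InW v × In i v)
  landmark? i v = inW? v ×-dec in? i v

  module _ {i} (big : 3 ≤ size i) {j} (w∈ : In i (W j)) where

    visible : Visible i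
    visible = big , j , w∈

    size-split : # (private? i) + # (shared? i) + # (landmark? i) ≡ size i
    size-split = begin
      # (private? i) + # (shared? i) + # (landmark? i)
        ≡⟨ cong (_+ # (landmark? i)) (∑-distrib-+ _ (λ v → ind (shared? i v))) ⟨
      sum (λ v → ind (private? i v) + ind (shared? i v)) + # (landmark? i)
        ≡⟨ ∑-distrib-+ _ (λ v → ind (landmark? i v)) ⟨
      sum (λ v → ind (private? i v) + ind (shared? i v) + ind (landmark? i v))
        ≡⟨ sum-cong-≗ (λ v → ind-split (inW? v) (visible? i) (in? i v) (deg v ≟ 1) visible) ⟩
      size i ∎
      where open ≡.≡-Reasoning

    pay-split : sum (pay i) + # (shared? i) + # (landmark? i) * 2 ≡ size i * 2
    pay-split = begin
      sum (pay i) + # (shared? i) + # (landmark? i) * 2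
        ≡⟨ cong₂ _+_ (∑-distrib-+ _ (λ v → ind (shared? i v))) (sum-*ʳ (λ v → ind (landmark? i v)) 2) ⟨
      sum (λ v → pay i v + ind (shared? i v)) + sum (λ v → ind (landmark? i v) * 2)
        ≡⟨ ∑-distrib-+ _ (λ v → ind (landmark? i v) * 2) ⟨
      sum (λ v → pay i v + ind (shared? i v) + ind (landmark? i v) * 2)
        ≡⟨ sum-cong-≗ (λ v → ind-pay-split (inW? v) (visible? i) (in? i v) (deg v ≟ 1) visible) ⟩
      sum (λ v → ind (in? i v) * 2)
        ≡⟨ sum-*ʳ (λ v → ind (in? i v)) 2 ⟩
      size i * 2 ∎
      where open ≡.≡-Reasoning

    only : # (landmark? i) ≤ 1 → Only i j
    only w≤1 = w∈ , λ j′ w′∈ → decidable-stable (j′ Fin.≟ j) λ j′≢j →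
      ≤⇒≯ w≤1 (#≥2 (landmark? i) ((j′ , refl) , w′∈) ((j , refl) , w∈) (j′≢j ∘ W-injective))

    -- κ(·, W j) is injective on the private vertices of a block whose only landmark is W j.
    private+a≤size : ∀ a → a ≤ size i → Only i j → (∀ v → Private i v → a ≤ κ v (W j)) →
                     # (private? i) + a ≤ size i
    private+a≤size a a≤ o low = begin
      # (private? i) + a  ≤⟨ +-monoˡ-≤ a (#-range (private? i) (λ v → κ v (W j)) a
                               (λ v p → low v p , <-≤-trans (κ<size p) (≤-reflexive (≡.sym (m+[n∸m]≡n a≤))))
                               (λ _ _ p q → private-injective o o p q)) ⟩
      size i ∸ a + a      ≡⟨ m∸n+n≡m a≤ ⟩
      size i ∎
      where
      open ≤-Reasoning
      κ<size : ∀ {v} → Private i v → κ v (W j) < size i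
      κ<size ((¬w , _ , v∈) , _) = proj₂ (κ-block i big v∈ w∈ (≢W ¬w j))

    -- By `pay-split` the first two terms are what the block keeps. Two landmarks already keep 4; a
    -- single one keeps 2, and shared vertices and the deficit supply the rest.
    needed : 4 ≤ # (shared? i) + # (landmark? i) * 2 + ind (deficient? i)
    needed with 2 ≤? # (landmark? i)
    ... | yes 2≤l = ≤-trans (*-monoˡ-≤ 2 2≤l) (≤-trans (m≤n+m _ (# (shared? i))) (m≤m+n _ _))
    ... | no 2≰l = subst (λ l → 4 ≤ # (shared? i) + l * 2 + ind (deficient? i)) (≡.sym l≡1)
                     (≤-trans (+-monoˡ-≤ 2 2≤s+g) (≤-reflexive (reorder (# (shared? i)) (ind (deficient? i)))))
      where
      l≤1 : # (landmark? i) ≤ 1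
      l≤1 = s≤s⁻¹ (≰⇒> 2≰l)
      l≡1 : # (landmark? i) ≡ 1
      l≡1 = ≤-antisym l≤1 (#-pos (landmark? i) ((j , refl) , w∈))
      reorder : ∀ s g → s + g + 2 ≡ s + 1 * 2 + g
      reorder s g = ≡.trans (+-assoc s g 2) (≡.trans (cong (s +_) (+-comm g 2)) (≡.sym (+-assoc s 2 g)))
      -- The extra 1 in `suc a` is the single landmark in `size-split`.
      shared≥ : ∀ a → # (private? i) + suc a ≤ size i → a ≤ # (shared? i)
      shared≥ a le = s≤s⁻¹ (+-cancelˡ-≤ (# (private? i)) _ _ (≤-trans le (≤-reflexive
        (≡.trans (≡.sym size-split) (≡.trans (cong (# (private? i) + # (shared? i) +_) l≡1)
          (≡.trans (+-assoc (# (private? i)) _ 1) (cong (# (private? i) +_) (+-comm _ 1))))))))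
      κ≥2 : ∀ v → Private i v → 2 ≤ κ v (W j)
      κ≥2 v ((¬w , _ , v∈) , _) = proj₁ (κ-block i big v∈ w∈ (≢W ¬w j))
      2≤s+g : 2 ≤ # (shared? i) + ind (deficient? i)
      2≤s+g with deficient? i
      -- Private values start at 2, which forces one shared vertex; the deficit is the second unit.
      ... | yes _ = +-monoˡ-≤ 1 (shared≥ 1 (private+a≤size 2 (≤-trans (n≤1+n 2) big) (only l≤1) κ≥2))
      -- Here private values start at 3, which forces two shared vertices.
      ... | no ¬deficient = ≤-trans (shared≥ 2 (private+a≤size 3 big (only l≤1) λ v p →
                         ≤∧≢⇒< (κ≥2 v p) λ e → ¬deficient (j , only l≤1 , v , p , ≡.sym e)))
                       (m≤m+n _ _)

  -- An invisible block pays nothing, and having two vertices it already owns 4. For a visible one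
  -- `needed` is combined with `pay-split`.
  block-pays : ∀ i → 4 + sum (pay i) ≤ size i * 2 + ind (deficient? i)
  block-pays i = by-visibility (visible? i)
    where
    open ≤-Reasoning
    open +-*-Solver
    by-visibility : Dec (Visible i) → 4 + sum (pay i) ≤ size i * 2 + ind (deficient? i)
    by-visibility (yes (big , j , w∈)) = begin
      4 + sum (pay i)
        ≤⟨ +-monoˡ-≤ _ (needed big w∈) ⟩
      # (shared? i) + # (landmark? i) * 2 + ind (deficient? i) + sum (pay i)
        ≡⟨ solve 4 (λ s l g p → s :+ l :+ g :+ p := p :+ s :+ l :+ g) refl
             (# (shared? i)) (# (landmark? i) * 2) (ind (deficient? i)) (sum (pay i)) ⟩
      sum (pay i) + # (shared? i) + # (landmark? i) * 2 + ind (deficient? i)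
        ≡⟨ cong (_+ ind (deficient? i)) (pay-split big w∈) ⟩
      size i * 2 + ind (deficient? i) ∎
    by-visibility (no ¬vis) = begin
      4 + sum (pay i)  ≡⟨ cong (4 +_) (sum-cong-≗ λ v →
                            cong (_* (1 + ind (deg v ≟ 1)))
                              (ind-no (visibleAt? v i) λ (_ , vis , _) → ¬vis vis)) ⟩
      4 + sum {n} (λ _ → 0)  ≡⟨ cong (4 +_) (≡.trans (sum-const n 0) (*-zeroʳ n)) ⟩
      4                ≤⟨ *-monoˡ-≤ 2 (size≥2 i) ⟩
      size i * 2       ≤⟨ m≤m+n _ _ ⟩
      size i * 2 + ind (deficient? i) ∎

  -- Double counting of the payments: `vertex-paid` summed over vertices against `block-pays` summed
  -- over blocks. The final 2 covers the hidden vertex.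
  total : b * 4 + # (λ v → ¬? (inW? v)) * 2 ≤ sum size * 2 + d + 2
  total = begin
    b * 4 + # (λ v → ¬? (inW? v)) * 2
      ≡⟨ cong (b * 4 +_) (sum-*ʳ (λ v → ind (¬? (inW? v))) 2) ⟨
    b * 4 + sum (λ v → ind (¬? (inW? v)) * 2)
      ≤⟨ +-monoʳ-≤ (b * 4) (sum-mono vertex-paid) ⟩
    b * 4 + sum (λ v → sum (λ i → pay i v) + ind (hidden? v) * 2)
      ≡⟨ cong (b * 4 +_) (∑-distrib-+ _ (λ v → ind (hidden? v) * 2)) ⟩
    b * 4 + (sum (λ v → sum (λ i → pay i v)) + sum (λ v → ind (hidden? v) * 2))
      ≡⟨ cong (b * 4 +_) (cong₂ _+_ (∑-comm (λ v i → pay i v)) (sum-*ʳ (λ v → ind (hidden? v)) 2)) ⟩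
    b * 4 + (sum (λ i → sum (pay i)) + # hidden? * 2)
      ≡⟨ +-assoc (b * 4) _ _ ⟨
    b * 4 + sum (λ i → sum (pay i)) + # hidden? * 2
      ≡⟨ cong (_+ # hidden? * 2) (≡.trans (∑-distrib-+ _ (λ i → sum (pay i)))
           (cong (_+ sum (λ i → sum (pay i))) (sum-const b 4))) ⟨
    sum (λ i → 4 + sum (pay i)) + # hidden? * 2
      ≤⟨ +-mono-≤ (sum-mono block-pays) (*-monoˡ-≤ 2 hidden≤1) ⟩
    sum (λ i → size i * 2 + ind (deficient? i)) + 2
      ≡⟨ cong (_+ 2) (≡.trans (∑-distrib-+ _ (λ i → ind (deficient? i))) (cong (_+ # deficient?) (sum-*ʳ size 2))) ⟩
    sum size * 2 + # deficient? + 2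
      ≤⟨ +-monoˡ-≤ 2 (+-monoʳ-≤ (sum size * 2) deficient≤d) ⟩
    sum size * 2 + d + 2 ∎
    where open ≤-Reasoning

  n≤d+outside : n ≤ d + # (λ v → ¬? (inW? v))
  n≤d+outside = begin
    n  ≡⟨ #-all n ⟨
    sum {n} (λ _ → 1)  ≤⟨ sum-mono (λ v → lem (inW? v)) ⟩
    sum (λ v → ind (inW? v) + ind (¬? (inW? v)))  ≡⟨ ∑-distrib-+ _ (λ v → ind (¬? (inW? v))) ⟩
    # inW? + # (λ v → ¬? (inW? v))
      ≤⟨ +-monoˡ-≤ _ (#-bound inW? (λ _ → proj₁) λ { _ _ (_ , e) (_ , e′) refl → ≡.trans (≡.sym e) e′ }) ⟩
    d + # (λ v → ¬? (inW? v)) ∎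
    where
    open ≤-Reasoning
    lem : (a? : Dec A) → 1 ≤ ind a? + ind (¬? a?)
    lem (yes _) = ≤-refl
    lem (no _)  = ≤-refl

  -- To avoid subtraction, `b * 2 + u * 2 + 2` is added to both sides, where `u` counts the vertices
  -- outside `W` and `n ≤ d + u`.
  blocks-bound : sum size + 1 ≤ n + b → 2 * b ≤ 3 * d
  blocks-bound forest = +-cancelˡ-≤ (b * 2 + u * 2 + 2) _ _ (begin
    b * 2 + u * 2 + 2 + 2 * b
      ≡⟨ solve 2 (λ b u → b :* con 2 :+ u :* con 2 :+ con 2 :+ con 2 :* b 
           := b :* con 4 :+ u :* con 2 :+ con 2) refl b u ⟩
    b * 4 + u * 2 + 2  ≤⟨ +-monoˡ-≤ 2 total ⟩
    sum size * 2 + d + 2 + 2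
      ≡⟨ solve 2 (λ s d → s :* con 2 :+ d :+ con 2 :+ con 2 
           := (s :+ con 1) :* con 2 :+ d :+ con 2) refl (sum size) d ⟩
    (sum size + 1) * 2 + d + 2
      ≤⟨ +-monoˡ-≤ 2 (+-monoˡ-≤ d (*-monoˡ-≤ 2 (≤-trans forest (+-monoˡ-≤ b n≤d+outside)))) ⟩
    (d + u + b) * 2 + d + 2
      ≡⟨ solve 3 (λ d u b → (d :+ u :+ b) :* con 2 :+ d :+ con 2 
           := b :* con 2 :+ u :* con 2 :+ con 2 :+ con 3 :* d) refl d u b ⟩
    b * 2 + u * 2 + 2 + 3 * d ∎)
    where
    open ≤-Reasoning
    open +-*-Solver
    u = # (λ v → ¬? (inW? v))

-- Walks and inseparability

private
  infix 4 _∈?_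
  _∈?_ : ∀ {n} (x : Fin n) (xs : List (Fin n)) → Dec (x ∈ xs)
  _∈?_ = DecMembership._∈?_ Fin._≟_

module _ {n : ℕ} {E : Fin n → Fin n → Bool} where

  start∈ : ∀ {u v p} → WalkL E u v p → u ∈ p
  start∈ (here _)   = here refl
  start∈ (step _ _) = here refl

  end∈ : ∀ {u v p} → WalkL E u v p → v ∈ p
  end∈ (here _)   = here refl
  end∈ (step _ w) = there (end∈ w)

  append : ∀ {u v w p q} → WalkL E u v p → WalkL E v w q →
           ∃ λ r → WalkL E u w r × (∀ {x} → x ∈ r → x ∈ p ⊎ x ∈ q)
  append (here _)   w₂ = _ , w₂ , inj₂
  append (step e w) w₂ with r , w′ , sub ← append w w₂ =
    _ , step e w′ , λ { (here refl) → inj₁ (here refl) ; (there x∈) → Sum.map₁ there (sub x∈) }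

  walk-map : ∀ {F : Fin n → Fin n → Bool} {u v p} →
             (∀ {a b} → a ∈ p → b ∈ p → T (E a b) → T (F a b)) → WalkL E u v p → WalkL F u v p
  walk-map f (here _)   = here _
  walk-map f (step e w) = step (f (here refl) (there (start∈ w)) e)
                               (walk-map (λ a∈ b∈ → f (there a∈) (there b∈)) w)

  suffix : ∀ {u v x p} → WalkL E u v p → Unique p → x ∈ p →
           ∃ λ q → WalkL E x v q × Unique q × q ⊆ p
  suffix w@(here _)   uq       (here refl) = _ , w , uq , id
  suffix w@(step _ _) uq       (here refl) = _ , w , uq , id
  suffix (step _ w)   (_ ∷ uq) (there x∈)  with q , w′ , uq′ , sub ← suffix w uq x∈ =
    q , w′ , uq′ , there ∘ sub

  simplify : ∀ {u v p} → WalkL E u v p → ∃ λ q → WalkL E u v q × Unique q × q ⊆ p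
  simplify (here v) = _ , here v , [] ∷ [] , id
  simplify (step {u} e w) with simplify w
  ... | q , w′ , uq , sub with u ∈? q
  ... | yes u∈ with q′ , w″ , uq′ , sub′ ← suffix w′ uq u∈ = q′ , w″ , uq′ , there ∘ sub ∘ sub′
  ... | no u∉ = u ∷ q , step e w′ , All.tabulate (λ x∈ e → u∉ (subst (_∈ q) (≡.sym e) x∈)) ∷ uq ,
                λ { (here refl) → here refl ; (there x∈) → there (sub x∈) }

  split-at : ∀ {u v x p} → WalkL E u v p → Unique p → x ∈ p →
             ∃₂ λ q r → WalkL E u x q × WalkL E x v r × q ⊆ p × r ⊆ p × (∀ {y} → y ∈ q → y ∈ r → y ≡ x)
  split-at w@(here _)   uq (here refl) = _ , _ , here _ , w , id , id , λ { (here e) _ → e }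
  split-at w@(step _ _) uq (here refl) =
    _ , _ , here _ , w , (λ { (here refl) → here refl }) , id , λ { (here e) _ → e }
  split-at (step e w) (u∉ ∷ uq) (there x∈)
    with q , r , w₁ , w₂ , q⊆ , r⊆ , meet ← split-at w uq x∈ =
    _ , _ , step e w₁ , w₂ , (λ { (here refl) → here refl ; (there y∈) → there (q⊆ y∈) }) , there ∘ r⊆ ,
    λ { (here refl) y∈r → contradiction refl (All.lookup u∉ (r⊆ y∈r)) ; (there y∈q) y∈r → meet y∈q y∈r }

  first-hit : ∀ {S : Fin n → Set} (S? : Decidable S) {u v p} → WalkL E u v p → S v →
              ∃₂ λ y q → S y × WalkL E u y q × q ⊆ p × (∀ {x} → x ∈ q → S x → x ≡ y)
  first-hit S? (here v) s = v , _ , s , here v , id , λ { (here e) _ → e }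
  first-hit S? (step {u} e w) s with S? u
  ... | yes su = u , _ , su , here u , (λ { (here refl) → here refl }) , λ { (here e) _ → e }
  ... | no ¬su with y , q , sy , w′ , sub , first ← first-hit S? w s =
    y , u ∷ q , sy , step e w′ , (λ { (here refl) → here refl ; (there x∈) → there (sub x∈) }) ,
    λ { (here refl) su → contradiction su ¬su ; (there x∈) → first x∈ }

  -- The last component makes the second vertex a faithful label for internally disjoint paths: if
  -- it is `v`, the whole path is the edge.
  second-vertex : ∀ {u v p} → WalkL E u v p → Unique p → u ≢ v →
                  ∃ λ x → x ∈ p × x ≢ u × T (E u x) × (x ≡ v → p ≡ u ∷ v ∷ [])
  second-vertex (here _) uq u≢v = contradiction refl u≢v
  second-vertex (step e (here v)) uq u≢v =
    v , there (here refl) , u≢v ∘ ≡.sym , e , λ _ → refl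
  second-vertex (step e (step {x} e′ w)) (u∉ ∷ x∉ ∷ _) u≢v =
    x , there (here refl) , All.lookup u∉ (here refl) ∘ ≡.sym , e ,
    λ { refl → contradiction refl (All.lookup x∉ (end∈ w)) }

  Within : (Fin n → Set) → Fin n → Fin n → Set
  Within S u v = ∃ λ p → WalkL E u v p × (∀ {x} → x ∈ p → S x)

  within-trans : ∀ {S u v w} → Within S u v → Within S v w → Within S u w
  within-trans (_ , w₁ , s₁) (_ , w₂ , s₂) with r , w , sub ← append w₁ w₂ =
    r , w , [ s₁ , s₂ ]′ ∘ sub

  within-refl : ∀ {S u} → S u → Within S u u
  within-refl su = _ , here _ , λ { (here refl) → su }

module Graphs {n : ℕ} (G : Graph n) where

  edge-sym : ∀ {u v} → T (adj G u v) → T (adj G v u)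
  edge-sym {u} {v} = subst T (Graph.sym G u v)

  edge-≢ : ∀ {u v} → T (adj G u v) → u ≢ v
  edge-≢ {u} e refl = subst T (Graph.irrefl G u) e

  Walk : Fin n → Fin n → List (Fin n) → Set
  Walk = WalkL (adj G)

  reverse : ∀ {u v p} → Walk u v p → ∃ λ q → Walk v u q × q ⊆ p
  reverse (here v) = _ , here v , id
  reverse (step {u} e w) with q , w′ , sub ← reverse w
    with r , w″ , sub′ ← append w′ (step (edge-sym e) (here u)) =
    r , w″ , λ x∈ → case sub′ x∈ of λ
      { (inj₁ x∈q) → there (sub x∈q)
      ; (inj₂ (here refl)) → there (start∈ w)
      ; (inj₂ (there (here refl))) → here refl }

  Avoids : Fin n → Fin n → Fin n → Set
  Avoids z = Within {E = adj G} (_≢ z)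

  avoids-sym : ∀ {z u v} → Avoids z u v → Avoids z v u
  avoids-sym (_ , w , av) with q , w′ , sub ← reverse w = q , w′ , av ∘ sub

  avoids : ∀ {z u v p} → Walk u v p → z ∉ p → Avoids z u v
  avoids w z∉ = _ , w , λ { x∈ refl → z∉ x∈ }

  infix 4 _∼_
  _∼_ : Fin n → Fin n → Set
  u ∼ v = ∀ z → z ≢ u → z ≢ v → Avoids z u v

  ∼-refl : ∀ {u} → u ∼ u
  ∼-refl z z≢u _ = within-refl (z≢u ∘ ≡.sym)

  ∼-sym : ∀ {u v} → u ∼ v → v ∼ u
  ∼-sym u∼v z z≢v z≢u = avoids-sym (u∼v z z≢u z≢v)

  edge⇒∼ : ∀ {u v} → T (adj G u v) → u ∼ v
  edge⇒∼ e z z≢u z≢v = avoids (step e (here _))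
    λ { (here refl) → z≢u refl ; (there (here refl)) → z≢v refl }

  -- A vertex `z` differs from `x` or from `y`, and the connection runs through that one.
  ∼-via-pair : ∀ {x y u v} → x ≢ y → u ∼ x → u ∼ y → v ∼ x → v ∼ y → u ∼ v
  ∼-via-pair {x} {y} x≢y ux uy vx vy z z≢u z≢v with z Fin.≟ x
  ... | no z≢x   = within-trans (ux z z≢u z≢x) (avoids-sym (vx z z≢v z≢x))
  ... | yes refl = within-trans (uy z z≢u x≢y) (avoids-sym (vy z z≢v x≢y))

  -- On a simple path, `z` lies on at most one side of `x`. If it blocks the way to one end, the
  -- other end is still reached, and `u ∼ v` leads from there to the first.
  on-path⇒∼ : ∀ {u v x p} → u ∼ v → Walk u v p → Unique p → x ∈ p → x ∼ u × x ∼ v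
  on-path⇒∼ {u} {v} {x} u∼v w uq x∈ with split-at w uq x∈
  ... | q , r , w₁ , w₂ , _ , _ , meet = x∼u , x∼v
    where
    x∼u : x ∼ u
    x∼u z z≢x z≢u with z ∈? q
    ... | no z∉q  = avoids-sym (avoids w₁ z∉q)
    ... | yes z∈q = within-trans (avoids w₂ z∉r) (∼-sym u∼v z (λ { refl → z∉r (end∈ w₂) }) z≢u)
      where z∉r : z ∉ r
            z∉r z∈r = z≢x (meet z∈q z∈r)
    x∼v : x ∼ v
    x∼v z z≢x z≢v with z ∈? r
    ... | no z∉r  = avoids w₂ z∉r
    ... | yes z∈r = within-trans (avoids-sym (avoids w₁ z∉q)) (u∼v z (λ { refl → z∉q (start∈ w₁) }) z≢v)
      where z∉q : z ∉ q
            z∉q z∈q = z≢x (meet z∈q z∈r)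

  -- For adjacent u and v both walks may be the edge uv.
  TwoWalks : Fin n → Fin n → Set
  TwoWalks u v = ∃₂ λ p q → Walk u v p × Walk u v q × (∀ {x} → x ∈ p → x ∈ q → x ≡ u ⊎ x ≡ v)

  -- Whitney's step: with r from x′ first meeting the walks p and q at y ∈ p, the new pair is
  -- p up to y followed by r reversed, and q followed by the edge x x′.
  detour : ∀ {u x x′ y p q r} → Walk u x p → Unique p → Walk u x q →
    (∀ {z} → z ∈ p → z ∈ q → z ≡ u ⊎ z ≡ x) → T (adj G x x′) →
    y ∈ p → y ≢ x → Walk x′ y r → (∀ {z} → z ∈ r → z ∈ q → z ≡ y) → TwoWalks u x′
  detour {u} {x} {x′} {y} {p} {q} {r} wp uq wq meet e y∈p y≢x wr hit
    with p₁ , p₂ , w₁ , w₂ , p₁⊆ , _ , meet₁₂ ← split-at wp uq y∈p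
    with r′ , wr′ , r′⊆ ← reverse wr
    with P , wP , P⊆ ← append w₁ wr′
    with Q , wQ , Q⊆ ← append wq (step e (here x′)) = P , Q , wP , wQ , λ z∈P z∈Q → meets (P⊆ z∈P) (Q⊆ z∈Q)
    where
    meets-q : ∀ {z} → z ∈ p₁ ⊎ z ∈ r′ → z ∈ q → z ≡ u
    meets-q (inj₁ z∈p₁) z∈q with meet (p₁⊆ z∈p₁) z∈q
    ... | inj₁ z≡u  = z≡u
    ... | inj₂ refl = contradiction (≡.sym (meet₁₂ z∈p₁ (end∈ w₂))) y≢x
    meets-q (inj₂ z∈r′) z∈q with hit (r′⊆ z∈r′) z∈q
    ... | refl with meet y∈p z∈q
    ... | inj₁ z≡u = z≡u
    ... | inj₂ y≡x = contradiction y≡x y≢x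
    meets : ∀ {z} → z ∈ p₁ ⊎ z ∈ r′ → z ∈ q ⊎ z ∈ x ∷ x′ ∷ [] → z ≡ u ⊎ z ≡ x′
    meets z∈ (inj₁ z∈q) = inj₁ (meets-q z∈ z∈q)
    meets z∈ (inj₂ (here refl)) = inj₁ (meets-q z∈ (end∈ wq))
    meets z∈ (inj₂ (there (here refl))) = inj₂ refl

  -- As `u ∼ x′`, some walk from `x′` to `u` avoids `x`. Cut at its first vertex on either path, it
  -- is the `r` of `detour`, and `y ≢ x` holds because `x` was avoided.
  two-walks-step : ∀ {u x x′} → TwoWalks u x → T (adj G x x′) → x ≢ u → u ∼ x′ → TwoWalks u x′
  two-walks-step {u} {x} (_ , _ , wp₀ , wq₀ , meet₀) e x≢u u∼x′
    with p , wp , up , p⊆ ← simplify wp₀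
    with q , wq , uq , q⊆ ← simplify wq₀
    with _ , wr₀ , av ← ∼-sym u∼x′ x (edge-≢ e) x≢u
    with first-hit (λ z → (z ∈? p) ⊎-dec (z ∈? q)) wr₀ (inj₁ (start∈ wp))
  ... | y , r , inj₁ y∈p , wr , r⊆ , hit =
    detour wp up wq (λ a b → meet₀ (p⊆ a) (q⊆ b)) e y∈p (av (r⊆ (end∈ wr))) wr (λ a b → hit a (inj₂ b))
  ... | y , r , inj₂ y∈q , wr , r⊆ , hit =
    detour wq uq wp (λ a b → meet₀ (p⊆ b) (q⊆ a)) e y∈q (av (r⊆ (end∈ wr))) wr (λ a b → hit a (inj₁ b))

  two-walks-along : ∀ {u x v p} → TwoWalks u x → Walk x v p →
    (∀ {z} → z ∈ p → z ≢ u × u ∼ z) → TwoWalks u v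
  two-walks-along tw (here _)   ok = tw
  two-walks-along tw (step e w) ok =
    two-walks-along (two-walks-step tw e (proj₁ (ok (here refl))) (proj₂ (ok (there (start∈ w)))))
                    w (ok ∘ there)

  two-walks : ∀ {u v p} → u ≢ v → u ∼ v → Walk u v p → TwoWalks u v
  two-walks {u} {v} u≢v u∼v w₀ with simplify w₀
  ... | _ , here _ , _ , _ = contradiction refl u≢v
  ... | _ , w@(step e w′) , uq@(u∉ ∷ _) , _ =
    -- The induction starts with the first edge taken twice; by `on-path⇒∼` every later vertex of
    -- the path is inseparable from `u`.
    two-walks-along (_ , _ , step e (here _) , step e (here _) , meet) w′
      λ z∈ → (λ { refl → All.lookup u∉ z∈ refl }) , ∼-sym (proj₁ (on-path⇒∼ u∼v w uq (there z∈)))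
    where
    meet : ∀ {a b x} → x ∈ a ∷ b ∷ [] → x ∈ a ∷ b ∷ [] → x ≡ a ⊎ x ≡ b
    meet (here e)         _ = inj₁ e
    meet (there (here e)) _ = inj₂ e

  disjoint-pair : ∀ {u v p q} → IsPath G u v p → IsPath G u v q → p ≢ q →
    (∀ {x} → x ∈ p → x ∈ q → x ≡ u ⊎ x ≡ v) → DisjPaths G u v 2
  disjoint-pair {u} {v} {p} {q} ip iq p≢q meet = record
    { paths = λ { zero → p ; (suc _) → q }
    ; isPath = λ { zero → ip ; (suc _) → iq }
    ; distinct = λ { zero zero i≢j → contradiction refl i≢j ; zero (suc _) _ → p≢q
                   ; (suc _) zero _ → p≢q ∘ ≡.sym ; (suc zero) (suc zero) i≢j → contradiction refl i≢j }
    ; disjoint = λ { zero zero i≢j → contradiction refl i≢j ; zero (suc _) _ x → meet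
                   ; (suc _) zero _ x a b → meet b a ; (suc zero) (suc zero) i≢j → contradiction refl i≢j } }

  -- Only the arc from `u` to `v` is deleted; this already excludes the walk `u ∷ v ∷ []`.
  not-edge : Fin n → Fin n → Fin n → Fin n → Bool
  not-edge u v a b = adj G a b ∧ not (⌊ a Fin.≟ u ⌋ ∧ ⌊ b Fin.≟ v ⌋)

  not-edgeˡ : ∀ {u v a b} → T (adj G a b) → b ≢ v → T (not-edge u v a b)
  not-edgeˡ {u} {v} {a} {b} e b≢v with adj G a b | a Fin.≟ u | b Fin.≟ v
  ... | true | _     | yes b≡v = contradiction b≡v b≢v
  ... | true | yes _ | no _    = tt
  ... | true | no _  | no _    = tt
  not-edgeʳ : ∀ {u v a b} → T (adj G a b) → a ≢ u → T (not-edge u v a b)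
  not-edgeʳ {u} {v} {a} {b} e a≢u with adj G a b | a Fin.≟ u
  ... | true | yes a≡u = contradiction a≡u a≢u
  ... | true | no _    = tt

  -- In the adjacent case the second path goes through t, with the edge uv deleted so that
  -- making it simple cannot collapse it to that edge.
  whitney : ∀ {u v t p} → u ≢ v → t ≢ u → t ≢ v → u ∼ v → t ∼ u → t ∼ v → Walk u v p → DisjPaths G u v 2
  whitney {u} {v} {t} u≢v t≢u t≢v u∼v t∼u t∼v w₀ with T? (adj G u v)
  ... | no ¬e with two-walks u≢v u∼v w₀
  ... | _ , _ , wp₀ , wq₀ , meet₀
    with p , wp , up , p⊆ ← simplify wp₀ | q , wq , uq , q⊆ ← simplify wq₀ =
    disjoint-pair (wp , up) (wq , uq) p≢q (λ a b → meet₀ (p⊆ a) (q⊆ b))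
    where
    p≢q : p ≢ q
    -- If the paths coincided, their second vertex would be common to both, hence equal to `v`,
    -- making `u` and `v` adjacent.
    p≢q refl with x , x∈ , x≢u , e , _ ← second-vertex wp up u≢v with meet₀ (p⊆ x∈) (q⊆ x∈)
    ... | inj₁ x≡u  = x≢u x≡u
    ... | inj₂ refl = ¬e e
  whitney {u} {v} {t} u≢v t≢u t≢v u∼v t∼u t∼v w₀ | yes e
    with _ , wa , ava ← ∼-sym t∼u v (u≢v ∘ ≡.sym) (t≢v ∘ ≡.sym)
    with _ , wb , avb ← t∼v u (t≢u ∘ ≡.sym) u≢v
    -- The first half never enters `v` and the second never leaves `u`, so neither uses the deleted
    -- arc.
    with _ , wc , _ ← append (walk-map {F = not-edge u v} (λ _ b∈ e → not-edgeˡ e (ava b∈)) wa)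
                             (walk-map {F = not-edge u v} (λ a∈ _ e → not-edgeʳ e (avb a∈)) wb)
    with q , wq , uq , _ ← simplify wc =
    disjoint-pair (step e (here v) , (u≢v ∷ []) ∷ [] ∷ [])
      (walk-map (λ _ _ → proj₁ ∘ Equivalence.to T-∧) wq , uq)
      (λ { refl → removed wq })
      (λ { (here e) _ → inj₁ e ; (there (here e)) _ → inj₂ e })
    where
    removed : ¬ WalkL (not-edge u v) u v (u ∷ v ∷ [])
    removed (step e (here _)) with adj G u v | u Fin.≟ u | v Fin.≟ v
    ... | true  | yes _ | yes _ = e
    ... | true  | no u≢ | _     = contradiction refl u≢
    ... | true  | yes _ | no v≢ = contradiction refl v≢
    ... | false | _     | _     = e

  -- A third vertex lies on at most one of the two paths.
  two-paths⇒∼ : ∀ {u v} → DisjPaths G u v 2 → u ∼ v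
  two-paths⇒∼ D z z≢u z≢v with z ∈? DisjPaths.paths D zero
  ... | no z∉  = avoids (proj₁ (DisjPaths.isPath D zero)) z∉
  ... | yes z∈ = avoids (proj₁ (DisjPaths.isPath D (suc zero))) λ z∈′ →
    [ z≢u , z≢v ]′ (DisjPaths.disjoint D zero (suc zero) (λ ()) z z∈ z∈′)

  -- The two paths cannot both be the edge, so one of them has an inner second vertex, to which
  -- `on-path⇒∼` applies.
  two-paths⇒third : ∀ {u v} → u ≢ v → DisjPaths G u v 2 → ∃ λ t → t ≢ u × t ≢ v × t ∼ u × t ∼ v
  two-paths⇒third {u} {v} u≢v D = 
    case (second-vertex (proj₁ (isPath zero)) (proj₂ (isPath zero)) u≢v ,
          second-vertex (proj₁ (isPath (suc zero))) (proj₂ (isPath (suc zero))) u≢v) of pick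
    where
    open DisjPaths D
    Second = λ (p : List (Fin n)) → ∃ λ x → (x ∈ p) × x ≢ u × T (adj G u x) × (x ≡ v → p ≡ u ∷ v ∷ [])
    third : ∀ i {x} → x ∈ paths i → x ≢ u → x ≢ v → ∃ λ t → t ≢ u × t ≢ v × t ∼ u × t ∼ v
    third i {x} x∈ x≢u x≢v =
      x , x≢u , x≢v , on-path⇒∼ (two-paths⇒∼ D) (proj₁ (isPath i)) (proj₂ (isPath i)) x∈
    pick : Second (paths zero) × Second (paths (suc zero)) → ∃ λ t → t ≢ u × t ≢ v × t ∼ u × t ∼ v
    pick ((x , x∈ , x≢u , _ , x≡v⇒) , (y , y∈ , y≢u , _ , y≡v⇒)) with x Fin.≟ v | y Fin.≟ v
    ... | no x≢v  | _       = third zero x∈ x≢u x≢v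
    ... | yes _   | no y≢v  = third (suc zero) y∈ y≢u y≢v
    ... | yes x≡v | yes y≡v = contradiction (≡.trans (x≡v⇒ x≡v) (≡.sym (y≡v⇒ y≡v)))
                                            (distinct zero (suc zero) λ ())

  -- The second vertices of the paths are distinct members of `S` other than `u`. It is applied with
  -- `S` a block and with `S` everything.
  paths-bound : ∀ {u v k} {S : Fin n → Set} (S? : Decidable S) → u ≢ v → DisjPaths G u v k →
    S u → (∀ {p x} → IsPath G u v p → x ∈ p → S x) → k < # S?
  paths-bound {u} {v} {k} {S} S? u≢v D Su inS = ≤-trans
    (s≤s (≤-trans (≤-reflexive (≡.sym (#-all k)))
      (#-injection (λ _ → yes tt) (λ x → S? x ×-dec ¬? (x Fin.≟ u)) (λ i _ → proj₁ (second i))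
        (λ i _ → let _ , x∈ , x≢u , _ = second i in inS (isPath i) x∈ , x≢u)
        (λ i j _ _ → second-injective i j))))
    (#-remove S? Su)
    where
    open DisjPaths D
    second : ∀ i → ∃ λ x → x ∈ paths i × x ≢ u × T (adj G u x) × (x ≡ v → paths i ≡ u ∷ v ∷ [])
    second i = second-vertex (proj₁ (isPath i)) (proj₂ (isPath i)) u≢v
    second-injective : ∀ i j → proj₁ (second i) ≡ proj₁ (second j) → i ≡ j
    second-injective i j eq with second i | second j
    second-injective i j refl | x , x∈i , x≢u , _ , x≡v⇒i | _ , x∈j , _ , _ , x≡v⇒j =
      decidable-stable (i Fin.≟ j) λ i≢j →
      [ x≢u , (λ x≡v → distinct i j i≢j (≡.trans (x≡v⇒i x≡v) (≡.sym (x≡v⇒j x≡v)))) ]′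
      (disjoint i j i≢j x x∈i x∈j)

  fewer-paths : ∀ {u v k m} → k ≤ m → DisjPaths G u v m → DisjPaths G u v k
  fewer-paths k≤m D = record
    { paths = paths ∘ ι ; isPath = isPath ∘ ι
    ; distinct = λ i j i≢j → distinct (ι i) (ι j) (i≢j ∘ Fin.inject≤-injective k≤m k≤m i j)
    ; disjoint = λ i j i≢j → disjoint (ι i) (ι j) (i≢j ∘ Fin.inject≤-injective k≤m k≤m i j) }
    where
    open DisjPaths D
    ι = λ i → inject≤ i k≤m

  one-path : ∀ {u v p} → Walk u v p → DisjPaths G u v 1
  one-path w with q , w′ , uq , _ ← simplify w = record
    { paths = λ _ → q ; isPath = λ _ → w′ , uq
    ; distinct = λ { zero zero i≢j → contradiction refl i≢j }
    ; disjoint = λ { zero zero i≢j → contradiction refl i≢j } }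

-- Blocks

another : ∀ {m} → 2 ≤ m → (v : Fin m) → ∃ λ u → u ≢ v
another (s≤s (s≤s _)) zero    = suc zero , λ ()
another (s≤s (s≤s _)) (suc _) = zero , λ ()

-- `avoids?` is assumed here; the final theorem provides it under a double negation.
module Blocks {n : ℕ} (G : Graph n) (2≤n : 2 ≤ n) (connected : Connected G)
  (avoids? : ∀ z u v → Dec (Graphs.Avoids G z u v)) where

  open Graphs G

  _∼?_ : ∀ u v → Dec (u ∼ v)
  u ∼? v = Fin.all? λ z → ¬? (z Fin.≟ u) →-dec ¬? (z Fin.≟ v) →-dec avoids? z u v

  subgraph-walk : ∀ (H : Subgraph G) {u v p} → T (vs H u) → WalkL (es H) u v p → ∀ {x} → x ∈ p → T (vs H x)
  subgraph-walk H u∈ (here _)   (here refl) = u∈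
  subgraph-walk H u∈ (step e w) (here refl) = u∈
  subgraph-walk H u∈ (step e w) (there x∈) =
    subgraph-walk H (proj₂ (proj₂ (es-sub H _ _ e))) w x∈

  forget : ∀ (H : Subgraph G) {u v p} → WalkL (es H) u v p → Walk u v p
  forget H = walk-map λ _ _ → proj₁ ∘ es-sub H _ _

  -- A vertex outside `H` is avoided by every walk in `H`; a vertex inside is not a cut vertex.
  nonseparable⇒∼ : ∀ {H : Subgraph G} → Nonseparable H → ∀ {u v} → T (vs H u) → T (vs H v) → u ∼ v
  nonseparable⇒∼ {H} ((_ , conn) , uncut) {u} {v} u∈ v∈ z z≢u z≢v with T? (vs H z)
  ... | no z∉ with p , w ← conn u v u∈ v∈ =
    avoids (forget H w) λ z∈p → z∉ (subgraph-walk H u∈ w z∈p)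
  ... | yes z∈ = decidable-stable (avoids? z u v) λ ¬av →
    uncut (z , z∈ , u , v , u∈ , v∈ , z≢u ∘ ≡.sym , z≢v ∘ ≡.sym ,
           λ (p , w , z∉p) → ¬av (avoids (forget H w) z∉p))

  clique? : ∀ x y u → Dec (u ∼ x × u ∼ y)
  clique? x y u = (u ∼? x) ×-dec (u ∼? y)

  -- For distinct `x ∼ y` this is the block through both, and by `∼-via-pair` any two of its
  -- vertices are inseparable.
  clique : Fin n → Fin n → Subgraph G
  clique x y = record
    { vs     = V
    ; es     = λ u v → adj G u v ∧ (V u ∧ V v)
    ; es-sym = λ u v → ≡.cong₂ _∧_ (Graph.sym G u v) (∧-comm (V u) (V v))
    ; es-sub = λ u v e → let e′ , uv = Equivalence.to T-∧ e in e′ , Equivalence.to T-∧ uv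
    }
    where V = λ u → ⌊ clique? x y u ⌋

  ∈clique : ∀ {x y u} → u ∼ x → u ∼ y → T (vs (clique x y) u)
  ∈clique {x} {y} {u} ux uy = fromWitness {a? = clique? x y u} (ux , uy)

  clique⇒∼ : ∀ {x y u} → T (vs (clique x y) u) → u ∼ x × u ∼ y
  clique⇒∼ {x} {y} {u} = toWitness {a? = clique? x y u}

  induced-edge : ∀ {x y u v} → T (adj G u v) → T (vs (clique x y) u) → T (vs (clique x y) v) →
                 T (es (clique x y) u v)
  induced-edge e u∈ v∈ = Equivalence.from T-∧ (e , Equivalence.from T-∧ (u∈ , v∈))

  module _ {x y : Fin n} (x≢y : x ≢ y) where

    -- By `on-path⇒∼` a simple path between members stays in the clique, so simplifying suffices.
    -- `q ⊆ p` preserves avoidance of a vertex.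
    clique-walk : ∀ {u v p} → T (vs (clique x y) u) → T (vs (clique x y) v) → Walk u v p →
                  ∃ λ q → WalkL (es (clique x y)) u v q × q ⊆ p
    clique-walk {u} {v} u∈ v∈ w with u Fin.≟ v
    ... | yes refl = _ , here u , λ { (here refl) → start∈ w }
    ... | no u≢v with q , w′ , uq , sub ← simplify w =
      q , walk-map (λ a∈ b∈ e → induced-edge e (inside a∈) (inside b∈)) w′ , sub
      where
      u∼v : u ∼ v
      u∼v = ∼-via-pair x≢y (proj₁ (clique⇒∼ u∈)) (proj₂ (clique⇒∼ u∈))
                           (proj₁ (clique⇒∼ v∈)) (proj₂ (clique⇒∼ v∈))
      inside : ∀ {a} → a ∈ q → T (vs (clique x y) a)
      inside a∈ with au , av ← on-path⇒∼ u∼v w′ uq a∈ = ∈clique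
        (∼-via-pair u≢v au av (∼-sym (proj₁ (clique⇒∼ u∈))) (∼-sym (proj₁ (clique⇒∼ v∈))))
        (∼-via-pair u≢v au av (∼-sym (proj₂ (clique⇒∼ u∈))) (∼-sym (proj₂ (clique⇒∼ v∈))))

    clique-nonseparable : x ∼ y → Nonseparable (clique x y)
    clique-nonseparable x∼y =
      ((x , ∈clique ∼-refl x∼y) , λ u v u∈ v∈ → let q , w , _ = clique-walk u∈ v∈ (proj₂ (connected u v))
                                                   in q , w) ,
      λ (z , z∈ , u , v , u∈ , v∈ , u≢z , v≢z , ¬w) →
        let _ , w , av  = ∼-via-pair x≢y (proj₁ (clique⇒∼ u∈)) (proj₂ (clique⇒∼ u∈))
                            (proj₁ (clique⇒∼ v∈)) (proj₂ (clique⇒∼ v∈)) z (u≢z ∘ ≡.sym) (v≢z ∘ ≡.sym)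
            q , w′ , sub = clique-walk u∈ v∈ w
        in ¬w (q , w′ , λ z∈q → av (sub z∈q) refl)

    nonseparable⊆clique : ∀ {H : Subgraph G} → Nonseparable H → T (vs H x) → T (vs H y) → H ⊆ₛ clique x y
    nonseparable⊆clique {H} ns x∈ y∈ = inside , λ u v e →
      let e′ , u∈ , v∈ = es-sub H u v e in induced-edge e′ (inside u u∈) (inside v v∈)
      where
      inside : ∀ u → T (vs H u) → T (vs (clique x y) u)
      inside u u∈ = ∈clique (nonseparable⇒∼ {H} ns u∈ x∈) (nonseparable⇒∼ {H} ns u∈ y∈)

    -- A nonseparable `H` above the clique contains `x` and `y`, so `nonseparable⊆clique` puts it
    -- back inside.
    clique-block : x ∼ y → IsBlock (clique x y)
    clique-block x∼y = clique-nonseparable x∼y , λ H ns (vs⊆ , es⊆) →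
      let H⊆ = nonseparable⊆clique {H} ns (vs⊆ x (∈clique ∼-refl x∼y)) (vs⊆ y (∈clique (∼-sym x∼y) ∼-refl))
      in (λ v → T-ext (vs⊆ v) (proj₁ H⊆ v)) , (λ u v → T-ext (es⊆ u v) (proj₂ H⊆ u v))
      where
      T-ext : ∀ {a b} → (T a → T b) → (T b → T a) → a ≡ b
      T-ext {true}  {true}  f g = refl
      T-ext {true}  {false} f g = contradiction tt f
      T-ext {false} {true}  f g = contradiction tt g
      T-ext {false} {false} f g = refl

  neighbour : ∀ v → ∃ λ u → T (adj G v u)
  neighbour v with u , u≢v ← another 2≤n v
    with _ , w , uq , _ ← simplify (proj₂ (connected v u))
    with x , _ , _ , e , _ ← second-vertex w uq (u≢v ∘ ≡.sym) = x , e

  -- If `v` were alone, the clique through `v` and a neighbour `u` would extend `H`, and maximality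
  -- would put `u` into `H`.
  block-has-two : ∀ {H : Subgraph G} → IsBlock H → ∃₂ λ u v → T (vs H u) × T (vs H v) × u ≢ v
  block-has-two {H} ((((v , v∈) , _) , _) , maximal) with Fin.any? (λ u → T? (vs H u) ×-dec ¬? (u Fin.≟ v))
  ... | yes (u , u∈ , u≢v) = u , v , u∈ , v∈ , u≢v
  ... | no alone with u , e ← neighbour v =
    u , v , subst T (≡.sym (proj₁ H≈ u)) (∈clique (∼-sym (edge⇒∼ e)) ∼-refl) , v∈ , edge-≢ e ∘ ≡.sym
    where
    is-v : ∀ a → T (vs H a) → a ≡ v
    is-v a a∈ = decidable-stable (a Fin.≟ v) λ a≢v → alone (a , a∈ , a≢v)
    H≈ = maximal (clique v u) (clique-nonseparable (edge-≢ e) (edge⇒∼ e))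
      ( (λ a a∈ → subst (T ∘ vs (clique v u)) (≡.sym (is-v a a∈)) (∈clique ∼-refl (edge⇒∼ e)))
      , (λ a b ab → let ab′ , a∈ , b∈ = es-sub H a b ab in
           contradiction (≡.trans (is-v a a∈) (≡.sym (is-v b b∈))) (edge-≢ ab′)))

  module Family {b : ℕ} (block : Fin b → Subgraph G) (isBlock : ∀ i → IsBlock (block i))
    (distinct : ∀ i j → block i ≈ₛ block j → i ≡ j)
    (complete : ∀ H → IsBlock H → ∃ λ i → H ≈ₛ block i) where

    In : Fin b → Fin n → Set
    In i v = T (vs (block i) v)

    in? : ∀ i → Decidable (In i)
    in? i v = T? (vs (block i) v)

    size : Fin b → ℕ
    size i = # (in? i)

    in⇒∼ : ∀ i {u v} → In i u → In i v → u ∼ v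
    in⇒∼ i = nonseparable⇒∼ {block i} (proj₁ (isBlock i))

    covered : ∀ {x y} → x ≢ y → x ∼ y → ∃ λ i → ∀ {u} → u ∼ x → u ∼ y → In i u
    covered {x} {y} x≢y x∼y with i , vs≈ , _ ← complete (clique x y) (clique-block x≢y x∼y) =
      i , λ {u} ux uy → subst T (vs≈ u) (∈clique ux uy)

    block≈clique : ∀ i {x y} → x ≢ y → In i x → In i y → block i ≈ₛ clique x y
    block≈clique i {x} {y} x≢y x∈ y∈ = proj₂ (isBlock i) (clique x y) (clique-nonseparable x≢y (in⇒∼ i x∈ y∈))
      (nonseparable⊆clique x≢y {block i} (proj₁ (isBlock i)) x∈ y∈)

    closed : ∀ i {x y u} → x ≢ y → In i x → In i y → u ∼ x → u ∼ y → In i u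
    closed i {u = u} x≢y x∈ y∈ ux uy = subst T (≡.sym (proj₁ (block≈clique i x≢y x∈ y∈) u)) (∈clique ux uy)

    -- Both blocks are `clique x y`.
    same-block : ∀ {i j x y} → x ≢ y → In i x → In i y → In j x → In j y → i ≡ j
    same-block {i} {j} x≢y xi yi xj yj
      with vi , ei ← block≈clique i x≢y xi yi | vj , ej ← block≈clique j x≢y xj yj =
      distinct i j
        ((λ v → ≡.trans (vi v) (≡.sym (vj v))) , (λ u v → ≡.trans (ei u v) (≡.sym (ej u v))))

    size≥2 : ∀ i → 2 ≤ size i
    size≥2 i with u , v , u∈ , v∈ , u≢v ← block-has-two {block i} (isBlock i) = #≥2 (in? i) u∈ v∈ u≢v

    -- Rooting the graph: the sum of the block sizes

    module Rooted (r : Fin n) where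

      -- v is a child of block i if i contains a vertex on the root's side of v.
      Child : Fin b → Fin n → Set
      Child i v = In i v × v ≢ r × ∃ λ u → In i u × u ≢ v × Avoids v r u

      child? : ∀ i → Decidable (Child i)
      child? i v = in? i v ×-dec ¬? (v Fin.≟ r) ×-dec
        Fin.any? λ u → in? i u ×-dec ¬? (u Fin.≟ v) ×-dec avoids? v r u

      -- If `u` and `u′` witness that `v` is a child of `i` and of `j`, then `u ∼ u′`: around `v` go
      -- through the root, around any other vertex go through `v`. So `u` also lies in `j`, and the
      -- blocks share `u` and `v`.
      one-parent : ∀ v → # (λ i → child? i v) ≤ ind (¬? (v Fin.≟ r))
      one-parent v = by-root (v Fin.≟ r)
        where
        by-root : (v≡r? : Dec (v ≡ r)) → # (λ i → child? i v) ≤ ind (¬? v≡r?)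
        by-root (yes v≡r) = #-bound (λ i → child? i v) (λ _ c → contradiction v≡r (proj₁ (proj₂ c)))
                               (λ _ _ c → contradiction v≡r (proj₁ (proj₂ c)))
        by-root (no _) = #≤1 (λ i → child? i v) same
          where
          same : ∀ i j → Child i v → Child j v → i ≡ j
          same i j (vi , _ , u , ui , u≢v , ru) (vj , _ , u′ , u′j , u′≢v , ru′) =
            same-block u≢v ui vi (closed j u′≢v u′j vj u∼u′ (in⇒∼ i ui vi)) vj
            where
            u∼u′ : u ∼ u′
            u∼u′ z z≢u z≢u′ with z Fin.≟ v
            ... | yes refl = within-trans (avoids-sym ru) ru′
            ... | no z≢v   = within-trans (in⇒∼ i ui vi z z≢u z≢v) (in⇒∼ j vj u′j z z≢v z≢u′)

      -- The vertex by which the block is entered from the root.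
      Gate : Fin b → Fin n → Set
      Gate i v = In i v × ¬ Child i v

      gate? : ∀ i → Decidable (Gate i)
      gate? i v = in? i v ×-dec ¬? (child? i v)

      first-of-two : ∀ u v → u ≢ v → Avoids v r u ⊎ Avoids u r v
      first-of-two u v u≢v
        with first-hit (λ x → (x Fin.≟ u) ⊎-dec (x Fin.≟ v)) (proj₂ (connected r u)) (inj₁ refl)
      ... | _ , _ , inj₁ refl , w , _ , first =
        inj₁ (_ , w , λ x∈ x≡v → u≢v (≡.trans (≡.sym (first x∈ (inj₂ x≡v))) x≡v))
      ... | _ , _ , inj₂ refl , w , _ , first =
        inj₂ (_ , w , λ x∈ x≡u → u≢v (≡.trans (≡.sym x≡u) (first x∈ (inj₁ x≡u))))

      -- Of two vertices of the block, the one that a walk from the root meets first makes the other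
      -- a child.
      gate-unique : ∀ i u v → Gate i u → Gate i v → u ≡ v
      gate-unique i u v (u∈ , ¬cu) (v∈ , ¬cv) = decidable-stable (u Fin.≟ v) λ u≢v →
        [ (λ av → ¬cv (v∈ , ≢r av , u , u∈ , u≢v , av))
        , (λ av → ¬cu (u∈ , ≢r av , v , v∈ , u≢v ∘ ≡.sym , av)) ]′ (first-of-two u v u≢v)
        where
        ≢r : ∀ {x y} → Avoids x r y → x ≢ r
        ≢r (_ , w , av) x≡r = av (start∈ w) (≡.sym x≡r)

      size≤ : ∀ i → size i ≤ 1 + # (child? i)
      size≤ i = begin
        size i  ≤⟨ sum-mono (λ v → split (in? i v) (child? i v)) ⟩
        sum (λ v → ind (gate? i v) + ind (child? i v))  ≡⟨ ∑-distrib-+ _ (λ v → ind (child? i v)) ⟩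
        # (gate? i) + # (child? i)  ≤⟨ +-monoˡ-≤ _ (#≤1 (gate? i) (gate-unique i)) ⟩
        1 + # (child? i) ∎
        where
        open ≤-Reasoning
        split : ∀ {A C : Set} (a? : Dec A) (c? : Dec C) → ind a? ≤ ind (a? ×-dec ¬? c?) + ind c?
        split (no _)  c?      = z≤n
        split (yes _) (yes _) = ≤-refl
        split (yes _) (no _)  = ≤-refl

      -- Each block has at most one gate besides its children. Counted by vertices, children number
      -- at most one per vertex other than the root.
      forest : sum size + 1 ≤ n + b
      forest = begin
        sum size + 1
          ≤⟨ +-monoˡ-≤ 1 (sum-mono size≤) ⟩
        sum (λ i → 1 + # (child? i)) + 1
          ≡⟨ cong (_+ 1) (≡.trans (∑-distrib-+ (λ _ → 1) (λ i → # (child? i)))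
               (cong₂ _+_ (#-all b) (∑-comm (λ i v → ind (child? i v))))) ⟩
        b + sum (λ v → # (λ i → child? i v)) + 1
          ≤⟨ +-monoˡ-≤ 1 (+-monoʳ-≤ b (sum-mono one-parent)) ⟩
        b + # (λ v → ¬? (v Fin.≟ r)) + 1
          ≡⟨ ≡.trans (+-assoc b _ 1) (cong (b +_) (+-comm _ 1)) ⟩
        b + suc (# (λ v → ¬? (v Fin.≟ r)))
          ≤⟨ +-monoʳ-≤ b (≤-trans (s≤s (sum-mono λ v →
               ind-mono (¬? (v Fin.≟ r)) (yes tt ×-dec ¬? (v Fin.≟ r)) (tt ,_)))
               (≤-trans (#-remove (λ _ → yes tt) {r} tt) (≤-reflexive (#-all n)))) ⟩
        b + n ≡⟨ +-comm b n ⟩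
        n + b ∎
        where open ≤-Reasoning

    -- Connectivity inside and across blocks

    module Connectivity (κ∃ : ∀ v w → ∃ λ k → v ≢ w → Kappa G v w (fin k)) where

      -- On the diagonal, where the true value is ∞, this number is arbitrary; the facts below
      -- concern distinct vertices.
      κ : Fin n → Fin n → ℕ
      κ v w = proj₁ (κ∃ v w)

      disjoint-paths⇒≤κ : ∀ {v w k} → v ≢ w → DisjPaths G v w k → k ≤ κ v w
      disjoint-paths⇒≤κ v≢w D = ≮⇒≥ λ κ<k → proj₂ (proj₂ (proj₂ (κ∃ _ _) v≢w)) (fewer-paths κ<k D)

      ≤κ⇒disjoint-paths : ∀ {v w k} → v ≢ w → k ≤ κ v w → DisjPaths G v w k
      ≤κ⇒disjoint-paths v≢w k≤κ = fewer-paths k≤κ (proj₁ (proj₂ (proj₂ (κ∃ _ _) v≢w)))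

      κ-unique : ∀ {v w k} → Kappa G v w (fin k) → k ≡ κ v w
      κ-unique (v≢w , D , ¬D) = ≤-antisym (disjoint-paths⇒≤κ v≢w D)
        (≮⇒≥ λ k<κ → ¬D (≤κ⇒disjoint-paths v≢w k<κ))

      κ-transfer : ∀ {u v w} → u ≢ w → v ≢ w → κ u w ≡ κ v w → ∀ x → Kappa G u w x → Kappa G v w x
      κ-transfer u≢w v≢w e ∞ u≡w = contradiction u≡w u≢w
      κ-transfer u≢w v≢w e (fin k) K rewrite κ-unique K | e = proj₂ (κ∃ _ _) v≢w

      -- Two paths would make `v ∼ w` and yield a third vertex inseparable from both, so the block
      -- through `v` and `w` would have at least 3 vertices.
      κ-apart : ∀ {v w} → v ≢ w → (∀ i → 3 ≤ size i → In i v → ¬ In i w) → κ v w ≡ 1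
      κ-apart {v} {w} v≢w apart = ≤-antisym (≮⇒≥ absurd)
        (disjoint-paths⇒≤κ v≢w (one-path (proj₂ (connected v w))))
        where
        absurd : ¬ 2 ≤ κ v w
        absurd 2≤κ
          with t , t≢v , t≢w , t∼v , t∼w ← two-paths⇒third v≢w (≤κ⇒disjoint-paths v≢w 2≤κ)
             | v∼w ← two-paths⇒∼ (≤κ⇒disjoint-paths v≢w 2≤κ)
          with i , ∈i ← covered v≢w v∼w =
          apart i (≤-trans (s≤s (#≥2 (λ x → in? i x ×-dec ¬? (x Fin.≟ t))
                    (v∈ , t≢v ∘ ≡.sym) (w∈ , t≢w ∘ ≡.sym) v≢w)) (#-remove (in? i) (∈i t∼v t∼w)))
                  v∈ w∈
          where v∈ = ∈i ∼-refl v∼w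
                w∈ = ∈i (∼-sym v∼w) ∼-refl

      -- The lower bound is `whitney` with a third vertex of the block; the upper one is
      -- `paths-bound`, as paths between `v` and `w` stay in the block.
      κ-block : ∀ i {v w} → 3 ≤ size i → In i v → In i w → v ≢ w → 2 ≤ κ v w × κ v w < size i
      κ-block i {v} {w} big v∈ w∈ v≢w = lower , upper
        where
        third : ∃ λ t → In i t × t ≢ v × t ≢ w
        third with Fin.any? (λ t → in? i t ×-dec ¬? (t Fin.≟ v) ×-dec ¬? (t Fin.≟ w))
        ... | yes t = t
        ... | no none =
          -- Without a third vertex the block would inject into `Fin 2` by telling `v` from `w`.
          contradiction (#-bound (in? i) (λ t _ → side t) λ t t′ t∈ t′∈ → side-injective t∈ t′∈) (<⇒≱ big)
          where
          side : Fin n → Fin 2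
          side t = if ⌊ t Fin.≟ v ⌋ then zero else suc zero
          is-w : ∀ {t} → In i t → t ≢ v → t ≡ w
          is-w {t} t∈ t≢v = decidable-stable (t Fin.≟ w) λ t≢w → none (t , t∈ , t≢v , t≢w)
          side-injective : ∀ {t t′} → In i t → In i t′ → side t ≡ side t′ → t ≡ t′
          side-injective {t} {t′} t∈ t′∈ e with t Fin.≟ v | t′ Fin.≟ v
          ... | yes t≡v | yes t′≡v = ≡.trans t≡v (≡.sym t′≡v)
          ... | no t≢v  | no t′≢v  = ≡.trans (is-w t∈ t≢v) (≡.sym (is-w t′∈ t′≢v))
          side-injective t∈ t′∈ () | yes _ | no _
          side-injective t∈ t′∈ () | no _  | yes _
        lower : 2 ≤ κ v w
        lower with t , t∈ , t≢v , t≢w ← third = disjoint-paths⇒≤κ v≢w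
          (whitney v≢w t≢v t≢w (in⇒∼ i v∈ w∈) (in⇒∼ i t∈ v∈) (in⇒∼ i t∈ w∈) (proj₂ (connected v w)))
        upper : κ v w < size i
        upper = paths-bound (in? i) v≢w (≤κ⇒disjoint-paths v≢w ≤-refl) v∈
          λ (wk , uq) x∈ → let xv , xw = on-path⇒∼ (in⇒∼ i v∈ w∈) wk uq x∈ in closed i v≢w v∈ w∈ xv xw

      bound : ∀ {d} (W : Fin d → Fin n) → Injective _≡_ _≡_ W → Resolving G W → 2 * b ≤ 3 * d
      bound W W-inj resolving = blocks-bound (Rooted.forest (root 2≤n))
        where
        root : ∀ {m} → 2 ≤ m → Fin m
        root (s≤s _) = zero
        κ-resolving : ∀ u v → ¬ (∃ λ j → W j ≡ u) → ¬ (∃ λ j → W j ≡ v) →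
                      (∀ j → κ u (W j) ≡ κ v (W j)) → u ≡ v
        κ-resolving u v u∉ v∉ e = resolving u v λ j x →
          κ-transfer (λ eq → u∉ (j , ≡.sym eq)) (λ eq → v∉ (j , ≡.sym eq)) (e j) x ,
          κ-transfer (λ eq → v∉ (j , ≡.sym eq)) (λ eq → u∉ (j , ≡.sym eq)) (≡.sym (e j)) x
        open Discharging In in? W W-inj κ size≥2 κ-apart κ-block κ-resolving

-- Classical choices under double negation, and the conclusion

¬¬-∀ : ∀ {n} {P : Fin n → Set} → (∀ i → ¬ ¬ P i) → ¬ ¬ (∀ i → P i)
¬¬-∀ = Fin.sequence (RawMonad.rawApplicative ¬¬-Monad)

-- Stands in for a maximum: `D` is not assumed decidable, so each stage of the descent from `m` uses
-- a doubly negated case distinction.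
¬¬-last : ∀ {D : ℕ → Set} → D 0 → ∀ m → ¬ D m → ¬ ¬ (∃ λ k → D k × ¬ D (suc k))
¬¬-last d₀ zero    ¬dm = contradiction d₀ ¬dm
¬¬-last {D} d₀ (suc m) ¬dm none = ¬¬-excluded-middle {A = D m} λ
  { (yes dm) → none (m , dm , ¬dm) ; (no ¬dm′) → ¬¬-last d₀ m ¬dm′ none }

¬¬-kappa : ∀ {n} (G : Graph n) v w → ¬ ¬ (∃ λ k → v ≢ w → Kappa G v w (fin k))
¬¬-kappa {n} G v w with v Fin.≟ w
-- The diagonal gets the dummy value 0.
... | yes v≡w = λ ¬κ → ¬κ (0 , λ v≢w → contradiction v≡w v≢w)
... | no v≢w  = ¬¬-map (λ (k , D , ¬D) → k , λ v≢w → v≢w , D , ¬D)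
  (¬¬-last (record { paths = λ () ; isPath = λ () ; distinct = λ () ; disjoint = λ () }) n too-many)
  where
  too-many : ¬ DisjPaths G v w n
  too-many D = <-irrefl (≡.sym (#-all n)) (Graphs.paths-bound G (λ _ → yes tt) v≢w D tt _)

theorem3p6 : ∀ (n : ℕ) (G : Graph n) → 2 ≤ n → Connected G →
    ∀ (b d : ℕ) → NumBlocks G b → IsCdim G d → b + 1 ≤ 2 * d
theorem3p6 n G 2≤n connected b d (B , isBlock , distinct , complete) ((W , W-inj , resolving) , _) =
  -- The goal is decidable, so it may be proved under double negation; there the finitely many
  -- decisions `avoids?` and values `κ∃` are available.
  decidable-stable (b + 1 ≤? 2 * d) λ ¬goal →
  ¬¬-∀ (λ z → ¬¬-∀ λ u → ¬¬-∀ λ v → ¬¬-excluded-middle) λ avoids? →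
  ¬¬-∀ (λ v → ¬¬-∀ (¬¬-kappa G v)) λ κ∃ →
  let open Blocks G 2≤n connected avoids?
      open Family B isBlock distinct complete
      open Connectivity κ∃
  in ¬goal (arith (bound W W-inj resolving) (d≥1 2≤n resolving))
  where
  -- Without landmarks all representations agree, yet there are two vertices.
  d≥1 : ∀ {n d} {G : Graph n} {W : Fin d → Fin n} → 2 ≤ n → Resolving G W → 1 ≤ d
  d≥1 {d = suc _} _ _ = s≤s z≤n
  d≥1 {d = zero} (s≤s (s≤s _)) resolving = contradiction (resolving zero (suc zero) λ ()) λ ()
  -- If `2 * d ≤ b`, then `4 * d ≤ 2 * b ≤ 3 * d`, which contradicts `1 ≤ d`.
  arith : ∀ {b d} → 2 * b ≤ 3 * d → 1 ≤ d → b + 1 ≤ 2 * d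
  arith {b} {d} 2b≤3d 1≤d = ≮⇒≥ λ 2d<b+1 → <⇒≱ (begin-strict
    3 * d        <⟨ m<n+m (3 * d) 1≤d ⟩
    d + 3 * d    ≡⟨ *-assoc 2 2 d ⟩
    2 * (2 * d)  ≤⟨ *-monoʳ-≤ 2 (m<1+n⇒m≤n (<-≤-trans 2d<b+1 (≤-reflexive (+-comm b 1)))) ⟩
    2 * b        ∎) 2b≤3d
    where open ≤-Reasoning
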